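{- Let $n>m\geq 1$ and $h\geq 1$. The modal logics of each of the classes $\mathcal{F}(m,n,h)$, $\mathcal{F}_*(m,n)$, $\mathcal{G}(m,h)$, $\mathcal{G}_*(m)$ have the finite model property.
   Context: Modal formulas are built from variables $p_1,p_2,\dots$, constants $\bot,\top$, Boolean connectives and a unary connective $\Diamond$. A frame is $(W,R)$ with $W\neq\emptyset$, $R\subseteq W\times W$; a model is a frame with a valuation $\theta$ assigning subsets of $W$ to variables; truth is defined as usual with $M,w\models\Diamond\varphi$ iff there is $v$ with $wRv$ and $M,v\models\varphi$. A formula is valid in a frame if it is true at every point of every model over it; $\mathrm{Log}\,\mathcal{C}$ is the set of formulas valid in all frames of the class $\mathcal{C}$. A logic has the finite model property (is finitely approximable) if it equals $\mathrm{Log}$ of some class of finite frames. $R^0$ is the identity, $R^{i+1}=R^i\circ R$, $R^*=\bigcup_{i\ge0}R^i$. An $(m,n)$-frame is a frame with $R^n\subseteq R^m$; $\mathcal{F}(m,n)$ is the class of all $(m,n)$-frames. A frame is $m$-transitive if $R^*=\bigcup_{0\le i\le m}R^i$; $\mathcal{G}(m)$ is the class of $m$-transitive frames. Clusters are the classes of $x\sim_R y\iff (xR^*y$ and $yR^*x)$; the skeleton is the partial order on clusters with $[x]\le[y]$ iff $xR^*y$; the height of a frame is the maximal cardinality of a chain in its skeleton. $\mathcal{F}(m,n,h)$ (resp. $\mathcal{G}(m,h)$) consists of frames in $\mathcal{F}(m,n)$ (resp. $\mathcal{G}(m)$) of height at most $h$; $\mathcal{F}_*(m,n)$ (resp. $\mathcal{G}_*(m)$)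 consists of frames in $\mathcal{F}(m,n)$ (resp. $\mathcal{G}(m)$) of finite height. -}

module Defs where

open import Level using (Level; 0ℓ) renaming (suc to lsuc)
open import Data.Nat using (ℕ; zero; suc; _≤_)
open import Data.Fin using (Fin; inject₁) renaming (suc to fsuc)
open import Data.Product using (Σ; ∃; ∃-syntax; _×_; _,_)
open import Data.Sum using (_⊎_)
open import Data.Empty using (⊥)
open import Data.Unit using (⊤)
open import Relation.Nullary using (¬_)
open import Relation.Binary.PropositionalEquality using (_≡_)
open import Function.Bundles using (_↔_; _⇔_)

data Fm : Set where
  var       : ℕ → Fm
  ⊥̇ ⊤̇       : Fm
  ¬̇_        : Fm → Fm
  _∧̇_ _∨̇_ _⇒̇_ : Fm → Fm → Fm
  ◇_        : Fm → Fm

-- Frames: nonempty carrier (witnessed by a point) and a relation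

record Frame : Set₁ where
  field
    W     : Set
    R     : W → W → Set
    point : W

open Frame public

Valuation : Frame → Set₁
Valuation F = ℕ → W F → Set

_,_⊨_at_ : (F : Frame) → Valuation F → Fm → W F → Set
F , θ ⊨ var p at w = θ p w
F , θ ⊨ ⊥̇ at w = ⊥
F , θ ⊨ ⊤̇ at w = ⊤
F , θ ⊨ ¬̇ φ at w = ¬ (F , θ ⊨ φ at w)
F , θ ⊨ (φ ∧̇ ψ) at w = (F , θ ⊨ φ at w) × (F , θ ⊨ ψ at w)
F , θ ⊨ (φ ∨̇ ψ) at w = (F , θ ⊨ φ at w) ⊎ (F , θ ⊨ ψ at w)
F , θ ⊨ (φ ⇒̇ ψ) at w = (F , θ ⊨ φ at w) → (F , θ ⊨ ψ at w)
F , θ ⊨ ◇ φ at w = ∃[ v ] (R F w v × (F , θ ⊨ φ at v))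

Valid : Frame → Fm → Set₁
Valid F φ = (θ : Valuation F) (w : W F) → F , θ ⊨ φ at w

FrameClass : Set₁
FrameClass = Frame → Set

Log : FrameClass → Fm → Set₁
Log C φ = (F : Frame) → C F → Valid F φ

Finite : Frame → Set
Finite F = ∃[ k ] (W F ↔ Fin k)

HasFMP : (Fm → Set₁) → Set₁
HasFMP L = Σ FrameClass λ D →
  ((F : Frame) → D F → Finite F) × ((φ : Fm) → L φ ⇔ Log D φ)

module _ (F : Frame) where
  Rpow : ℕ → W F → W F → Set
  Rpow zero x y = x ≡ y
  Rpow (suc i) x y = ∃[ z ] (Rpow i x z × R F z y)

  R* : W F → W F → Set
  R* x y = ∃[ i ] Rpow i x y

  -- strict order of the skeleton, on representatives: [x] < [y]
  _<ₛ_ : W F → W F → Set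
  x <ₛ y = R* x y × ¬ R* y x

IsMN : ℕ → ℕ → Frame → Set
IsMN m n F = ∀ x y → Rpow F n x y → Rpow F m x y

-- m-transitive: R* = ⋃_{0≤i≤m} R^i  (the inclusion ⊇ is automatic)
IsMTrans : ℕ → Frame → Set
IsMTrans m F = ∀ x y → R* F x y → ∃[ i ] (i ≤ m × Rpow F i x y)

-- height ≤ h: no chain of h+1 clusters in the skeleton, i.e. no strictly
-- increasing sequence [x₀] < [x₁] < ... < [x_h]
HeightLe : ℕ → Frame → Set
HeightLe h F = ¬ (Σ (Fin (suc h) → W F) λ x →
                    (i : Fin h) → _<ₛ_ F (x (inject₁ i)) (x (fsuc i)))

FiniteHeight : Frame → Set
FiniteHeight F = ∃[ h ] HeightLe h F

𝓕 : ℕ → ℕ → ℕ → FrameClass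
𝓕 m n h F = IsMN m n F × HeightLe h F

𝓕* : ℕ → ℕ → FrameClass
𝓕* m n F = IsMN m n F × FiniteHeight F

𝓖 : ℕ → ℕ → FrameClass
𝓖 m h F = IsMTrans m F × HeightLe h F

𝓖* : ℕ → FrameClass
𝓖* m F = IsMTrans m F × FiniteHeight F

{-# OPTIONS --safe #-}
-- Let e be n − m for (m,n)-frames and 1 for m-transitive frames.  Suppose a
-- colouring π of F by finitely many colours satisfies: whenever π x = π x′ and
-- x R y, some y′ with π y′ = π y is reached from x′ by a path of length ≡ 1 mod e.
-- Then a path of length k in the minimal filtration through π lifts to a path of
-- length k + j e in F, and the condition on F shortens the latter; hence the
-- filtration stays in the class, and its height does not grow.  Such a colouring
-- exists when the height is finite: up to the residues mod e of path lengths every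
-- cluster is a cycle of at most e blocks, so recursively on the depth there are
-- finitely many descriptions of a point by the colours in its cluster and the
-- descriptions strictly above it, each sorted by the residues of path lengths.
module Submission where

open import Defs
open import Level using (0ℓ; Lift; lift; lower) renaming (suc to lsuc)
open import Data.Nat using (ℕ; zero; suc; _+_; _*_; _^_; _≤_; _<_; z≤n)
open import Data.Nat.Properties using (+-identityʳ; +-assoc; +-comm; +-suc; m≤n⇒∃[o]m+o≡n)
open import Data.Nat.DivMod using (_%_; _/_; m≡m%n+[m/n]*n; m%n<n)
open import Data.Nat.Divisibility
  using (_∣_; divides; ∣m∣n⇒∣m+n; ∣m+n∣m⇒∣n; n∣m*n; m∣m*n; ∣-refl)
open import Data.Nat.Tactic.RingSolver using (solve-∀)
open import Data.Fin using (Fin; zero; inject₁; toℕ; fromℕ<; combine; funToFin; finToFun)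
  renaming (suc to fsuc)
open import Data.Fin.Properties
  using (combine-injective; finToFun-funToFin; toℕ-fromℕ<)
open import Data.Product using (Σ; ∃-syntax; _×_; _,_; proj₁; proj₂)
open import Data.Sum using (inj₁; inj₂)
open import Data.Empty using (⊥; ⊥-elim)
open import Data.Unit using (tt)
open import Function using (_∘_)
open import Function.Bundles using (mk⇔)
open import Function.Construct.Identity using (↔-id)
open import Relation.Nullary using (Dec; yes; no; ¬_)
open import Relation.Nullary.Decidable using (map′)
open import Relation.Binary.PropositionalEquality
  using (_≡_; refl; sym; trans; cong; cong₂; subst)
open import Axiom.ExcludedMiddle using (ExcludedMiddle)

-- Numerical codes for finite tables and truth values.

funToFin-injective : ∀ {m n} (f g : Fin m → Fin n) → funToFin f ≡ funToFin g → ∀ i → f i ≡ g i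
funToFin-injective f g eq i =
  trans (sym (finToFun-funToFin f i))
        (trans (cong (λ k → finToFun k i) eq) (finToFun-funToFin g i))

funToFin-cong : ∀ {m n} (f g : Fin m → Fin n) → (∀ i → f i ≡ g i) → funToFin f ≡ funToFin g
funToFin-cong {zero}  f g eq = refl
funToFin-cong {suc m} f g eq =
  cong₂ combine (eq zero) (funToFin-cong (f ∘ fsuc) (g ∘ fsuc) (eq ∘ fsuc))

bit : {P : Set} → Dec P → Fin 2
bit (yes _) = zero
bit (no _)  = fsuc zero

bit-sound : {P Q : Set} (p : Dec P) (q : Dec Q) → bit p ≡ bit q → P → Q
bit-sound _        (yes q) _  _ = q
bit-sound (yes _)  (no _)  () _
bit-sound (no ¬p)  (no _)  _  p = ⊥-elim (¬p p)

bit-complete : {P Q : Set} (p : Dec P) (q : Dec Q) → (P → Q) → (Q → P) → bit p ≡ bit q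
bit-complete (yes _) (yes _) _ _ = refl
bit-complete (yes p) (no ¬q) f _ = ⊥-elim (¬q (f p))
bit-complete (no ¬p) (yes q) _ g = ⊥-elim (¬p (g q))
bit-complete (no _)  (no _)  _ _ = refl

-- Path composition, depth and height.

module _ {F : Frame} where

  Rpow-++ : ∀ i j {x y z} → Rpow F i x y → Rpow F j y z → Rpow F (j + i) x z
  Rpow-++ i zero    p refl        = p
  Rpow-++ i (suc j) p (u , q , r) = u , Rpow-++ i j p q , r

  Rpow-split : ∀ i j {x z} → Rpow F (j + i) x z → ∃[ y ] (Rpow F i x y × Rpow F j y z)
  Rpow-split i zero    p           = _ , p , refl
  Rpow-split i (suc j) (u , p , r) with y , p′ , q ← Rpow-split i j p = y , p′ , u , q , r

  Rpow-iterate : ∀ i j {x} → Rpow F i x x → Rpow F (j * i) x x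
  Rpow-iterate i zero    p = refl
  Rpow-iterate i (suc j) p = Rpow-++ (j * i) i (Rpow-iterate i j p) p

  R*-trans : ∀ {x y z} → R* F x y → R* F y z → R* F x z
  R*-trans (i , p) (j , q) = j + i , Rpow-++ i j p q

  R⇒R* : ∀ {x y} → R F x y → R* F x y
  R⇒R* r = 1 , _ , refl , r

  -- Applying the frame condition to the first `m + e` steps removes `e` of them; after `suc j`
  -- applications exactly `m` steps remain.
  IsMN-shorten : ∀ m e → IsMN m (m + e) F → ∀ j {x y} → Rpow F (m + e + j * e) x y → Rpow F m x y
  IsMN-shorten m e mn zero {x} {y} p = mn x y (subst (λ k → Rpow F k x y) (+-identityʳ (m + e)) p)
  IsMN-shorten m e mn (suc j) {x} {z} p
    with y , p₁ , p₂ ← Rpow-split (m + e) (e + j * e)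
                         (subst (λ k → Rpow F k x z) (+-comm (m + e) (e + j * e)) p)
    = IsMN-shorten m e mn j
        (subst (λ k → Rpow F k x z) (rearrange m e (j * e)) (Rpow-++ m (e + j * e) (mn x y p₁) p₂))
    where
    rearrange : ∀ m e a → e + a + m ≡ m + e + a
    rearrange = solve-∀

-- A pointwise height bound that supports recursion. The count includes `x` itself, so depth 0 is
-- impossible.
DepthLe : (F : Frame) → ℕ → W F → Set
DepthLe F zero    x = ⊥
DepthLe F (suc k) x = ∀ y → _<ₛ_ F x y → DepthLe F k y

Depth⇒HeightLe : (F : Frame) → ∀ h → (∀ x → DepthLe F h x) → HeightLe h F
Depth⇒HeightLe F h depth (x , ascending) = go h x ascending (depth (x zero))
  where
  go : ∀ h (x : Fin (suc h) → W F) → ((i : Fin h) → _<ₛ_ F (x (inject₁ i)) (x (fsuc i))) →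
       ¬ DepthLe F h (x zero)
  go zero    x a d = d
  go (suc h) x a d = go h (x ∘ fsuc) (a ∘ fsuc) (d (x (fsuc zero)) (a zero))

module Classical (dec : (P : Set) → Dec P) where

  by-contradiction : {P : Set} → ¬ ¬ P → P
  by-contradiction {P} ¬¬p with dec P
  ... | yes p = p
  ... | no ¬p = ⊥-elim (¬¬p ¬p)

  -- Classically, a failing depth bound yields a strict successor at which the next smaller bound
  -- fails; iterating builds a forbidden chain.
  Height⇒DepthLe : (F : Frame) → ∀ h → HeightLe h F → ∀ x → DepthLe F h x
  Height⇒DepthLe F h H x = by-contradiction λ ¬d → H (forget (chain h x ¬d))
    where
    Chain : ℕ → W F → Set
    Chain h x = Σ (Fin (suc h) → W F) λ f →
                  f zero ≡ x × ((i : Fin h) → _<ₛ_ F (f (inject₁ i)) (f (fsuc i)))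

    forget : ∀ {h x} → Chain h x →
             Σ (Fin (suc h) → W F) λ f → (i : Fin h) → _<ₛ_ F (f (inject₁ i)) (f (fsuc i))
    forget (f , _ , a) = f , a

    cons : ∀ {h x y} → _<ₛ_ F x y → Chain h y → Chain (suc h) x
    cons {x = x} x<y (f , refl , a) =
      (λ { zero → x ; (fsuc i) → f i }) , refl , (λ { zero → x<y ; (fsuc i) → a i })

    chain : ∀ h x → ¬ DepthLe F h x → Chain h x
    chain zero    x ¬d = (λ _ → x) , refl , λ ()
    chain (suc h) x ¬d with dec (∃[ y ] (_<ₛ_ F x y × ¬ DepthLe F h y))
    ... | yes (y , x<y , ¬dy) = cons x<y (chain h y ¬dy)
    ... | no none = ⊥-elim (¬d λ y x<y → by-contradiction λ ¬dy → none (y , x<y , ¬dy))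

  module _ (m n : ℕ) where

    profile : (Fin m → Fin n → Set) → Fin ((2 ^ n) ^ m)
    profile Q = funToFin λ i → funToFin λ a → bit (dec (Q i a))

    profile-sound : ∀ Q Q′ → profile Q ≡ profile Q′ → ∀ i a → Q i a → Q′ i a
    profile-sound Q Q′ eq i a =
      bit-sound (dec (Q i a)) (dec (Q′ i a))
        (funToFin-injective _ _ (funToFin-injective _ _ eq i) a)

    profile-complete : ∀ Q Q′ → (∀ i a → Q i a → Q′ i a) → (∀ i a → Q′ i a → Q i a) →
                       profile Q ≡ profile Q′
    profile-complete Q Q′ f g =
      funToFin-cong _ _ λ i → funToFin-cong _ _ λ a → bit-complete _ _ (f i a) (g i a)

  -- Construction of a tuned colouring.

  Tuned : (F : Frame) (e : ℕ) {K : ℕ} → (W F → Fin K) → Set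
  Tuned F e π = ∀ {x x′ y} → π x ≡ π x′ → R F x y →
                ∃[ y′ ] ∃[ j ] (π y ≡ π y′ × Rpow F (1 + j * e) x′ y′)

  module TunedColouring (F : Frame) (d : ℕ) {N : ℕ} (c : W F → Fin N) where

    e : ℕ
    e = suc d

    -- There is a nonempty path from x to y of length ≡ − i mod e.
    Path : ℕ → W F → W F → Set
    Path i x y = ∃[ l ] (Rpow F (suc l) x y × e ∣ suc l + i)

    Path-step : ∀ {x y} → R F x y → Path d x y
    Path-step r = 0 , (_ , refl , r) , ∣-refl

    Path-% : ∀ i {x y} → Path i x y → Path (i % e) x y
    Path-% i (l , p , div) = l , p , ∣m+n∣m⇒∣n (subst (e ∣_) eq div) (n∣m*n (i / e))
      where
      rearrange : ∀ a b c → a + (b + c) ≡ c + (a + b)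
      rearrange = solve-∀
      eq : suc l + i ≡ i / e * e + (suc l + i % e)
      eq = trans (cong (suc l +_) (m≡m%n+[m/n]*n i e)) (rearrange (suc l) (i % e) (i / e * e))

    Path-%⁻¹ : ∀ i {x y} → Path (i % e) x y → Path i x y
    Path-%⁻¹ i (l , p , div) = l , p , subst (e ∣_) eq (∣m∣n⇒∣m+n div (n∣m*n (i / e)))
      where
      eq : suc l + i % e + i / e * e ≡ suc l + i
      eq = trans (+-assoc (suc l) (i % e) _) (cong (suc l +_) (sym (m≡m%n+[m/n]*n i e)))

    Path-∘ : ∀ {i j x y z} → Path i x y → Path j y z → Path (i + j) x z
    Path-∘ {i} {j} (k , p , div) (l , q , div′) =
      l + suc k , Rpow-++ (suc k) (suc l) p q , subst (e ∣_) (rearrange k l i j) (∣m∣n⇒∣m+n div div′)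
      where
      rearrange : ∀ k l i j → suc k + i + (suc l + j) ≡ suc (l + suc k) + (i + j)
      rearrange = solve-∀

    -- Going e − 1 times around a closed path through x and y first inverts the residue.
    Path-cancel : ∀ {i j x y z} → Path i x y → R* F y x → Path (i + j) x z → Path j y z
    Path-cancel {i} {j} {y = y} (k , p , div) (b , q) (l , r , div′) =
      l + back , Rpow-++ back (suc l) (Rpow-++ (d * s) b (Rpow-iterate s d loop) q) r ,
      ∣m+n∣m⇒∣n (subst (e ∣_) (rearrange d b k i j l) (∣m∣n⇒∣m+n (m∣m*n s) div′)) div
      where
      s back : ℕ
      s = suc k + b
      back = b + d * s
      loop : Rpow F s y y
      loop = Rpow-++ b (suc k) q p
      rearrange : ∀ d b k i j l →
        suc d * (suc k + b) + (suc l + (i + j)) ≡ suc k + i + (suc (l + (b + d * (suc k + b))) + j)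
      rearrange = solve-∀

    ClusterInvariant : (W F → W F → Set) → Set
    ClusterInvariant P = ∀ {x y z} → R* F x y → R* F y x → P x z → P y z

    Within Beyond : W F → W F → Set
    Within x y = R* F y x
    Beyond x y = ¬ R* F y x

    Within-invariant : ClusterInvariant Within
    Within-invariant xy yx zx = R*-trans zx xy

    Beyond-invariant : ClusterInvariant Beyond
    Beyond-invariant xy yx ¬zx zy = ¬zx (R*-trans zy yx)

    module _ {M : ℕ} (P : W F → W F → Set) (g : W F → Fin M) where

      Sees : W F → ℕ → Fin M → Set
      Sees x i a = ∃[ y ] (Path i x y × P x y × g y ≡ a)

      Sees-% : ∀ {x} i {a} → Sees x i a → Sees x (i % e) a
      Sees-% i (y , p , rest) = y , Path-% i p , rest

      Sees-%⁻¹ : ∀ {x} i {a} → Sees x (i % e) a → Sees x i a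
      Sees-%⁻¹ i (y , p , rest) = y , Path-%⁻¹ i p , rest

      -- Residues below `e` suffice, since `Sees` depends on `i` only modulo `e`; this keeps the
      -- table finite.
      view : W F → Fin ((2 ^ M) ^ e)
      view x = profile e M λ i → Sees x (toℕ i)

      view-sound : ∀ {x x′} → view x ≡ view x′ → ∀ i a → Sees x i a → Sees x′ i a
      view-sound {x} {x′} eq i a s =
        Sees-%⁻¹ i (subst (λ k → Sees x k a → Sees x′ k a) (toℕ-fromℕ< i<e)
          (profile-sound e M (λ i → Sees x (toℕ i)) (λ i → Sees x′ (toℕ i)) eq (fromℕ< i<e) a)
          (Sees-% i s))
        where
        i<e : i % e < e
        i<e = m%n<n i e

      view-complete : ∀ {x x′} → (∀ i a → Sees x i a → Sees x′ i a) →
                      (∀ i a → Sees x′ i a → Sees x i a) → view x ≡ view x′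
      view-complete f g = profile-complete e M _ _ (λ i → f (toℕ i)) (λ i → g (toℕ i))

      module _ (inv : ClusterInvariant P) where

        -- Together with `Sees-forth`: two points of one cluster have the same views up to a shift
        -- of the residues by the path joining them.
        Sees-back : ∀ {i j x y a} → Path i x y → R* F y x → Sees y j a → Sees x (i + j) a
        Sees-back p@(_ , p₁ , _) yx (z , q , yz , eq) =
          z , Path-∘ p q , inv yx (_ , p₁) yz , eq

        Sees-forth : ∀ {i j x y a} → Path i x y → R* F y x → Sees x (i + j) a → Sees y j a
        Sees-forth p@(_ , p₁ , _) yx (z , q , xz , eq) =
          z , Path-cancel p yx q , inv (_ , p₁) yx xz , eq

    size : ℕ → ℕ
    size zero    = 1
    size (suc k) = N * ((2 ^ N) ^ e * (2 ^ size k) ^ e)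

    -- code k is meant for points of depth at most k.
    code : ∀ k → W F → Fin (size k)
    code zero    x = zero
    code (suc k) x = combine (c x) (combine (view Within c x) (view Beyond (code k) x))

    -- One half of the equality of codes at level `suc k`; the other half is obtained by exchanging
    -- the points.
    record Sim (k : ℕ) (x x′ : W F) : Set where
      constructor mkSim
      field
        colour : c x ≡ c x′
        within : ∀ i a → Sees Within c x i a → Sees Within c x′ i a
        beyond : ∀ i a → Sees Beyond (code k) x i a → Sees Beyond (code k) x′ i a

    open Sim

    code-sound : ∀ k {x x′} → code (suc k) x ≡ code (suc k) x′ → Sim k x x′
    code-sound k {x} {x′} eq
      with eq₁ , eq₂₃ ← combine-injective (c x) _ (c x′) _ eq
      with eq₂ , eq₃ ← combine-injective (view Within c x) _ (view Within c x′) _ eq₂₃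
      = mkSim eq₁ (view-sound Within c eq₂) (view-sound Beyond (code k) eq₃)

    code-complete : ∀ k {x x′} → Sim k x x′ → Sim k x′ x → code (suc k) x ≡ code (suc k) x′
    code-complete k s s′ =
      cong₂ combine (colour s)
        (cong₂ combine (view-complete Within c (within s) (within s′))
                       (view-complete Beyond (code k) (beyond s) (beyond s′)))

    -- Once `k` bounds the depth, a further level adds no information: points strictly above have
    -- smaller depth, where by induction their codes already determine the next ones.
    code-stable : ∀ k {x x′} → DepthLe F k x → DepthLe F k x′ →
                  code k x ≡ code k x′ → code (suc k) x ≡ code (suc k) x′
    code-stable (suc k) dx dx′ eq =
      code-complete (suc k) (lifted dx dx′ (code-sound k eq)) (lifted dx′ dx (code-sound k (sym eq)))
      where
      lifted : ∀ {x x′} → DepthLe F (suc k) x → DepthLe F (suc k) x′ → Sim k x x′ → Sim (suc k) x x′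
      lifted {x} {x′} dx dx′ s = mkSim (colour s) (within s) up
        where
        up : ∀ i a → Sees Beyond (code (suc k)) x i a → Sees Beyond (code (suc k)) x′ i a
        up i a (y , p@(_ , p₁ , _) , ¬yx , eqy)
          with y′ , p′@(_ , p₁′ , _) , ¬y′x′ , eqy′ ← beyond s i (code k y) (y , p , ¬yx , refl)
          = y′ , p′ , ¬y′x′ ,
            trans (code-stable k (dx′ y′ ((_ , p₁′) , ¬y′x′)) (dx y ((_ , p₁) , ¬yx)) eqy′) eqy

    -- A view of `y` is pulled back to `x`, moved to `x′` by similarity, and pushed on to `y′`. The
    -- two shifts cancel because both paths have the same residue.
    Sim-along : ∀ k {i x x′ y y′} → Sim k x x′ → Path i x y → R* F y x →
                Path i x′ y′ → R* F y′ x′ → c y ≡ c y′ → Sim k y y′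
    Sim-along k s p yx p′ y′x′ eq = mkSim eq
      (λ j a → Sees-forth Within c Within-invariant p′ y′x′ ∘ within s _ a
               ∘ Sees-back Within c Within-invariant p yx)
      (λ j a → Sees-forth Beyond (code k) Beyond-invariant p′ y′x′ ∘ beyond s _ a
               ∘ Sees-back Beyond (code k) Beyond-invariant p yx)

    Path⇒Rpow : ∀ {x y} → Path d x y → ∃[ j ] Rpow F (1 + j * e) x y
    Path⇒Rpow (l , p , div)
      -- Since `suc l + d` is `e + l`, divisibility by `e` passes to `l`: residue index `d` means
      -- length 1 modulo `e`.
      with divides j eq ← ∣m+n∣m⇒∣n (subst (e ∣_) (trans (+-comm (suc l) d) (+-suc d l)) div) ∣-refl
      = j , subst (λ k → Rpow F (suc k) _ _) eq p

    code-tuned : ∀ h → (∀ x → DepthLe F h x) → Tuned F e (code h)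
    code-tuned zero depth {x} = ⊥-elim (depth x)
    code-tuned (suc k) depth {x} {x′} {y} eq r = result (dec (R* F y x))
      where
      s : Sim k x x′
      s = code-sound k eq

      result : Dec (R* F y x) →
               ∃[ y′ ] ∃[ j ] (code (suc k) y ≡ code (suc k) y′ × Rpow F (1 + j * e) x′ y′)
      -- Inside the cluster the view only matches the colour of `y`; `Sim-along` raises this to
      -- equality of codes.
      result (yes yx) with y′ , p′ , y′x′ , eqy ← within s d (c y) (y , Path-step r , yx , refl) =
        y′ , proj₁ (Path⇒Rpow p′) ,
        code-complete k (Sim-along k s (Path-step r) yx p′ y′x′ (sym eqy))
                        (Sim-along k (code-sound k (sym eq)) p′ y′x′ (Path-step r) yx eqy) ,
        proj₂ (Path⇒Rpow p′)
      -- Beyond the cluster the view matches codes one level down, which is enough because `y` and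
      -- `y′` have depth at most `k`.
      result (no ¬yx)
        with y′ , p′@(_ , p₁′ , _) , ¬y′x′ , eqy ←
               beyond s d (code k y) (y , Path-step r , ¬yx , refl) =
        y′ , proj₁ (Path⇒Rpow p′) ,
        code-stable k (depth x y (R⇒R* r , ¬yx)) (depth x′ y′ ((_ , p₁′) , ¬y′x′)) (sym eqy) ,
        proj₂ (Path⇒Rpow p′)

    code-refines : ∀ h → (∀ x → DepthLe F h x) → ∀ {x x′} → code h x ≡ code h x′ → c x ≡ c x′
    code-refines zero    depth {x} _  = ⊥-elim (depth x)
    code-refines (suc k) depth     eq = colour (code-sound k eq)

  -- Truth values and the minimal filtration.

  -- Records the truth values of the variables and ◇-formulas occurring in a formula.
  truthSize : Fm → ℕ
  truthSize (var p)  = 2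
  truthSize ⊥̇        = 1
  truthSize ⊤̇        = 1
  truthSize (¬̇ φ)    = truthSize φ
  truthSize (φ ∧̇ ψ) = truthSize φ * truthSize ψ
  truthSize (φ ∨̇ ψ) = truthSize φ * truthSize ψ
  truthSize (φ ⇒̇ ψ) = truthSize φ * truthSize ψ
  truthSize (◇ φ)    = 2 * truthSize φ

  truth : (F : Frame) → Valuation F → (φ : Fm) → W F → Fin (truthSize φ)
  truth F θ (var p)  x = bit (dec (θ p x))
  truth F θ ⊥̇        x = zero
  truth F θ ⊤̇        x = zero
  truth F θ (¬̇ φ)    x = truth F θ φ x
  truth F θ (φ ∧̇ ψ) x = combine (truth F θ φ x) (truth F θ ψ x)
  truth F θ (φ ∨̇ ψ) x = combine (truth F θ φ x) (truth F θ ψ x)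
  truth F θ (φ ⇒̇ ψ) x = combine (truth F θ φ x) (truth F θ ψ x)
  truth F θ (◇ φ)    x = combine (bit (dec (F , θ ⊨ ◇ φ at x))) (truth F θ φ x)

  -- Colours outside the image of π are isolated irreflexive points of the filtration.
  module Filtration (F : Frame) {K : ℕ} (π : W F → Fin K) where

    Q : Frame
    Q = record
      { W = Fin K
      ; R = λ q q′ → ∃[ x ] ∃[ y ] (π x ≡ q × π y ≡ q′ × R F x y)
      ; point = π (point F)
      }

    Rpow-image : ∀ k {x y} → Rpow F k x y → Rpow Q k (π x) (π y)
    Rpow-image zero    refl        = refl
    Rpow-image (suc k) (z , p , r) = π z , Rpow-image k p , _ , _ , refl , refl , r

    -- Edges of `Q` come from edges of `F`, so colours outside the image start only empty paths.
    source : ∀ k {q q′} → Rpow Q (suc k) q q′ → ∃[ x ] π x ≡ q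
    source zero    (_ , refl , x , _ , eq , _) = x , eq
    source (suc k) (_ , p , _)                 = source k p

    module _ (θ : Valuation F) where

      θ̄ : Valuation Q
      θ̄ p q = ∃[ x ] (π x ≡ q × θ p x)

      Refines : Fm → Set
      Refines φ = ∀ {x y} → π x ≡ π y → truth F θ φ x ≡ truth F θ φ y

      -- truth treats ∨̇ and ⇒̇ like ∧̇, so the two lemmas below also apply to them.
      Refines-∧ˡ : ∀ φ ψ → Refines (φ ∧̇ ψ) → Refines φ
      Refines-∧ˡ φ ψ ref {x} {y} eq =
        proj₁ (combine-injective (truth F θ φ x) (truth F θ ψ x)
                                 (truth F θ φ y) (truth F θ ψ y) (ref eq))

      Refines-∧ʳ : ∀ φ ψ → Refines (φ ∧̇ ψ) → Refines ψ
      Refines-∧ʳ φ ψ ref {x} {y} eq =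
        proj₂ (combine-injective (truth F θ φ x) (truth F θ ψ x)
                                 (truth F θ φ y) (truth F θ ψ y) (ref eq))

      ◇-bit : Fm → W F → Fin 2
      ◇-bit φ x = bit (dec (F , θ ⊨ ◇ φ at x))

      Refines-◇ˡ : ∀ φ → Refines (◇ φ) → ∀ {x y} → π x ≡ π y → ◇-bit φ x ≡ ◇-bit φ y
      Refines-◇ˡ φ ref {x} {y} eq =
        proj₁ (combine-injective (◇-bit φ x) (truth F θ φ x) (◇-bit φ y) (truth F θ φ y) (ref eq))

      Refines-◇ʳ : ∀ φ → Refines (◇ φ) → Refines φ
      Refines-◇ʳ φ ref {x} {y} eq =
        proj₂ (combine-injective (◇-bit φ x) (truth F θ φ x) (◇-bit φ y) (truth F θ φ y) (ref eq))

      filtered    : ∀ φ → Refines φ → ∀ {x} → F , θ ⊨ φ at x → Q , θ̄ ⊨ φ at π x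
      filtered⁻¹  : ∀ φ → Refines φ → ∀ {x} → Q , θ̄ ⊨ φ at π x → F , θ ⊨ φ at x

      filtered (var p) ref t = _ , refl , t
      filtered ⊤̇ ref t = tt
      filtered (¬̇ φ) ref t s = t (filtered⁻¹ φ ref s)
      filtered (φ ∧̇ ψ) ref (s , t) = filtered φ (Refines-∧ˡ φ ψ ref) s , filtered ψ (Refines-∧ʳ φ ψ ref) t
      filtered (φ ∨̇ ψ) ref (inj₁ s) = inj₁ (filtered φ (Refines-∧ˡ φ ψ ref) s)
      filtered (φ ∨̇ ψ) ref (inj₂ t) = inj₂ (filtered ψ (Refines-∧ʳ φ ψ ref) t)
      filtered (φ ⇒̇ ψ) ref t s = filtered ψ (Refines-∧ʳ φ ψ ref) (t (filtered⁻¹ φ (Refines-∧ˡ φ ψ ref) s))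
      filtered (◇ φ) ref (y , r , t) =
        π y , (_ , y , refl , refl , r) , filtered φ (Refines-◇ʳ φ ref) t

      filtered⁻¹ (var p) ref {x} (y , eq , t) = bit-sound (dec (θ p y)) (dec (θ p x)) (ref eq) t
      filtered⁻¹ ⊤̇ ref t = tt
      filtered⁻¹ (¬̇ φ) ref t s = t (filtered φ ref s)
      filtered⁻¹ (φ ∧̇ ψ) ref (s , t) = filtered⁻¹ φ (Refines-∧ˡ φ ψ ref) s , filtered⁻¹ ψ (Refines-∧ʳ φ ψ ref) t
      filtered⁻¹ (φ ∨̇ ψ) ref (inj₁ s) = inj₁ (filtered⁻¹ φ (Refines-∧ˡ φ ψ ref) s)
      filtered⁻¹ (φ ∨̇ ψ) ref (inj₂ t) = inj₂ (filtered⁻¹ ψ (Refines-∧ʳ φ ψ ref) t)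
      filtered⁻¹ (φ ⇒̇ ψ) ref t s = filtered⁻¹ ψ (Refines-∧ʳ φ ψ ref) (t (filtered φ (Refines-∧ˡ φ ψ ref) s))
      -- The edge of `Q` starts at some `u` of the same colour as `x`; the recorded truth value of
      -- `◇ φ` carries truth from `u` to `x`.
      filtered⁻¹ (◇ φ) ref {x} (_ , (u , v , πu≡πx , refl , r) , t) =
        bit-sound (dec (F , θ ⊨ ◇ φ at u)) (dec (F , θ ⊨ ◇ φ at x)) (Refines-◇ˡ φ ref πu≡πx)
          (v , r , filtered⁻¹ φ (Refines-◇ʳ φ ref) t)

    module _ (e : ℕ) (tuned : Tuned F e π) where

      -- The next edge of `Q` may start at another representative than the point reached so far;
      -- tunedness continues from that point, at the cost of a multiple of `e` extra steps.
      Rpow-lift : ∀ k {x q} → Rpow Q k (π x) q →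
                  ∃[ y ] ∃[ j ] (π y ≡ q × Rpow F (k + j * e) x y)
      Rpow-lift zero {x} refl = x , 0 , refl , refl
      Rpow-lift (suc k) {x} (_ , p , u , v , πu≡ , refl , r)
        with y , j , πy≡ , p₁ ← Rpow-lift k p
        with y′ , j′ , πv≡ , p₂ ← tuned (trans πu≡ (sym πy≡)) r
        = y′ , j′ + j , sym πv≡ ,
          subst (λ i → Rpow F i x y′) (rearrange k j j′ e) (Rpow-++ (k + j * e) (1 + j′ * e) p₁ p₂)
        where
        rearrange : ∀ k j j′ e → 1 + j′ * e + (k + j * e) ≡ suc k + (j′ + j) * e
        rearrange = solve-∀

      R*-lift : ∀ {x q} → R* Q (π x) q → ∃[ y ] (π y ≡ q × R* F x y)
      R*-lift (k , p) with y , j , eq , p′ ← Rpow-lift k p = y , eq , _ , p′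

      R*-image : ∀ {x y} → R* F x y → R* Q (π x) (π y)
      R*-image (k , p) = k , Rpow-image k p

      -- A strict ascent in `Q` lifts to one in `F`: a way back in `F` would project to a way back
      -- in `Q`.
      DepthLe-image : ∀ k {x} → DepthLe F k x → DepthLe Q k (π x)
      DepthLe-image (suc k) dx q (up , ¬down) with y , refl , xy ← R*-lift up =
        DepthLe-image k (dx y (xy , λ yx → ¬down (R*-image yx)))

      HeightLe-filtration : ∀ h → (∀ x → DepthLe F h x) → HeightLe h Q
      HeightLe-filtration zero    depth = ⊥-elim (depth (point F))
      -- As `q` may lie outside the image, its depth is bounded through its strict successors;
      -- having one puts `q` in the image by `source`.
      HeightLe-filtration (suc h) depth = Depth⇒HeightLe Q (suc h) λ q q′ q<q′ → go q′ q<q′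
        where
        go : ∀ {q} q′ → _<ₛ_ Q q q′ → DepthLe Q h q′
        go q′ ((zero , refl) , ¬down) = ⊥-elim (¬down (0 , refl))
        go q′ (up@(suc k , p) , ¬down) with x , refl ← source k p =
          DepthLe-image (suc h) (depth x) q′ (up , ¬down)

    IsMN-filtration : ∀ m e → Tuned F (suc e) π → IsMN m (m + suc e) F → IsMN m (m + suc e) Q
    IsMN-filtration m e tuned mn q q′ p
      with x , refl ← source (m + e) (subst (λ k → Rpow Q k q q′) (+-suc m e) p)
      with y , j , refl , p′ ← Rpow-lift (suc e) tuned (m + suc e) p
      = Rpow-image m (IsMN-shorten m (suc e) mn j p′)

    IsMTrans-filtration : ∀ m → Tuned F 1 π → IsMTrans m F → IsMTrans m Q
    -- The empty path is separate because `q` need not be in the image. Otherwise modulus 1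
    -- suffices: the length of the lift is irrelevant.
    IsMTrans-filtration m tuned mt q q′ (zero , eq) = 0 , z≤n , eq
    IsMTrans-filtration m tuned mt q q′ (suc k , p)
      with x , refl ← source k p
      with y , refl , xy ← R*-lift 1 tuned (suc k , p)
      with i , i≤m , p′ ← mt x y xy
      = i , i≤m , Rpow-image i p′

  -- From closure under filtration to the finite model property.

  module _ (C : FrameClass) (d : ℕ)
           (height : ∀ {F} → C F → ∃[ h ] HeightLe h F)
           (closed : ∀ {F K} (π : W F → Fin K) (CF : C F) → Tuned F (suc d) π →
                     HeightLe (proj₁ (height CF)) (Filtration.Q F π) → C (Filtration.Q F π)) where

    closed⇒HasFMP : HasFMP (Log C)
    closed⇒HasFMP = (λ F → Finite F × C F) , (λ F → proj₁) , λ φ →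
      mk⇔ (λ valid F D → valid F (proj₂ D)) (complete φ)
      where
      complete : ∀ φ → Log (λ F → Finite F × C F) φ → Log C φ
      complete φ valid F CF θ x =
        filtered⁻¹ θ φ (code-refines h depth)
          (valid Q ((_ , ↔-id _) , closed π CF tuned (HeightLe-filtration (suc d) tuned h depth))
            (θ̄ θ) (π x))
        where
        open TunedColouring F d (truth F θ φ)
        h = proj₁ (height CF)
        depth = Height⇒DepthLe F h (proj₂ (height CF))
        π = code h
        tuned = code-tuned h depth
        open Filtration F π

theorem2 : ExcludedMiddle (lsuc Level.zero) →
    (m n h : ℕ) → 1 ≤ m → m < n → 1 ≤ h →
    HasFMP (Log (𝓕 m n h)) × HasFMP (Log (𝓕* m n))
    × HasFMP (Log (𝓖 m h)) × HasFMP (Log (𝓖* m))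
theorem2 em m n h 1≤m m<n 1≤h with e , refl ← m≤n⇒∃[o]m+o≡n m<n =
  -- Here `n` is `suc m + e`, so the modulus `n − m` is `suc e`, and the parameter `d`, one less
  -- than the modulus, is `e` for the first two classes and 0 for the others.
  subst (λ n → HasFMP (Log (𝓕 m n h)) × HasFMP (Log (𝓕* m n))
               × HasFMP (Log (𝓖 m h)) × HasFMP (Log (𝓖* m))) (+-suc m e)
  ( closed⇒HasFMP (𝓕 m (m + suc e) h) e (λ CF → h , proj₂ CF)
      (λ {F} π CF t H → Filtration.IsMN-filtration F π m e t (proj₁ CF) , H)
  , closed⇒HasFMP (𝓕* m (m + suc e)) e proj₂
      (λ {F} π CF t H → Filtration.IsMN-filtration F π m e t (proj₁ CF) , _ , H)
  , closed⇒HasFMP (𝓖 m h) 0 (λ CF → h , proj₂ CF)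
      (λ {F} π CF t H → Filtration.IsMTrans-filtration F π m t (proj₁ CF) , H)
  , closed⇒HasFMP (𝓖* m) 0 proj₂
      (λ {F} π CF t H → Filtration.IsMTrans-filtration F π m t (proj₁ CF) , _ , H) )
  where
  open Classical (λ P → map′ lower lift (em {Lift (lsuc 0ℓ) P}))
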